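{- Let $f:\mathbb{N}\to\mathbb{N}$ be a function. Then the following two conditions are equivalent: (i) for all positive natural numbers $m,n$, $\;f(\gcd(m,n))=\gcd(f(m),f(n))$; (ii) for all positive natural numbers $x,y$, $\;\gcd(f(x),f(y))=\gcd(f(x+y),f(y))$.
   Context: $\mathbb{N}$ denotes the natural numbers including $0$. The greatest common divisor is taken with respect to the divisibility ordering on $\mathbb{N}$, i.e. $\gcd(m,n)$ is the unique natural number such that, for all $k\in\mathbb{N}$, $k\mid m$ and $k\mid n$ if and only if $k\mid \gcd(m,n)$; in particular $\gcd(m,0)=m$ and $\gcd(0,0)=0$. -}

module Defs where

{-# OPTIONS --safe #-}
module Submission where

open import Data.Nat using (ℕ; suc; _+_; _<_; s≤s; z≤n; compare; less; equal; greater)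
open import Data.Nat.Divisibility using (_∣_; ∣-antisym; ∣-refl; ∣m∣n⇒∣m+n; ∣m+n∣m⇒∣n)
open import Data.Nat.GCD using (gcd; gcd[m,n]∣m; gcd[m,n]∣n; gcd-greatest; gcd-comm)
open import Data.Nat.Induction using (<-wellFounded)
open import Data.Nat.Properties using (+-comm; m<m+n; m<n+m)
open import Function.Bundles using (_⇔_; mk⇔)
open import Induction.WellFounded using (Acc; acc)
open import Level using (Level)
open import Relation.Binary.Core using (Rel)
open import Relation.Binary.Definitions using (Symmetric)
open import Relation.Binary.PropositionalEquality
  using (_≡_; refl; sym; trans; cong; subst; module ≡-Reasoning)
open import Defs

-- Both directions rest on gcd (x + y) y = gcd x y.  For (ii) ⇒ (i), condition (ii) says that
-- a subtractive Euclid step (x + y , y) ↦ (x , y) changes neither side of (i), and the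
-- algorithm ends at a pair (n , n), where (i) reads f n = f n.

gcd-idem : ∀ n → gcd n n ≡ n
gcd-idem n = ∣-antisym (gcd[m,n]∣m n n) (gcd-greatest ∣-refl ∣-refl)

-- Both pairs have the same common divisors: a divisor of `n` divides `m + n` exactly when it
-- divides `m`.
gcd[m+n,n]≡gcd[m,n] : ∀ m n → gcd (m + n) n ≡ gcd m n
gcd[m+n,n]≡gcd[m,n] m n = ∣-antisym
  (gcd-greatest (∣m+n∣m⇒∣n (subst (gcd (m + n) n ∣_) (+-comm m n) (gcd[m,n]∣m (m + n) n))
                           (gcd[m,n]∣n (m + n) n))
                (gcd[m,n]∣n (m + n) n))
  (gcd-greatest (∣m∣n⇒∣m+n (gcd[m,n]∣m m n) (gcd[m,n]∣n m n))
                (gcd[m,n]∣n m n))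

module _ {ℓ : Level} (P : Rel ℕ ℓ) (P-sym : Symmetric P) (P-diag : ∀ n → P n n)
         (P-step : ∀ x y → 0 < x → 0 < y → P x y → P (x + y) y) where

  -- Well-founded recursion on the sum of the pair: replacing the larger entry by the difference
  -- lowers the sum by the smaller entry, which is a strict decrease because that entry is positive.
  euclid-induction : ∀ m n → 0 < m → 0 < n → P m n
  euclid-induction m n = go m n (<-wellFounded (m + n))
    where
    go : ∀ m n → Acc _<_ (m + n) → 0 < m → 0 < n → P m n
    go m n _ _ _ with compare m n
    -- Here `n` is `suc (m + k)`, so the difference `suc k` is positive by construction. `P-step`
    -- enlarges the first entry only, while the larger entry here is the second; hence `P-sym`.
    go m _ (acc rec) 0<m _ | less m k =
      P-sym (subst (λ z → P z m) (cong suc (+-comm k m))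
        (P-step (suc k) m (s≤s z≤n) 0<m
          (go (suc k) m
              (rec (subst (_< m + suc (m + k)) (cong suc (+-comm m k)) (m<n+m (suc (m + k)) 0<m)))
              (s≤s z≤n) 0<m)))
    go m _ _ _ _ | equal m = P-diag m
    go _ n (acc rec) _ 0<n | greater n k =
      subst (λ z → P z n) (cong suc (+-comm k n))
        (P-step (suc k) n (s≤s z≤n) 0<n
          (go (suc k) n
              (rec (subst (_< suc (n + k) + n) (cong suc (+-comm n k)) (m<m+n (suc (n + k)) 0<n)))
              (s≤s z≤n) 0<n))

mainTheorem1 : (f : ℕ → ℕ) →
    (∀ (m n : ℕ) → 0 < m → 0 < n → f (gcd m n) ≡ gcd (f m) (f n))
    ⇔ (∀ (x y : ℕ) → 0 < x → 0 < y → gcd (f x) (f y) ≡ gcd (f (x + y)) (f y))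
mainTheorem1 f = mk⇔ preserves⇒invariant invariant⇒preserves
  where
  open ≡-Reasoning

  preserves⇒invariant :
    (∀ m n → 0 < m → 0 < n → f (gcd m n) ≡ gcd (f m) (f n)) →
    ∀ x y → 0 < x → 0 < y → gcd (f x) (f y) ≡ gcd (f (x + y)) (f y)
  -- Matching on `s≤s` exposes `x` as a successor, so that `x + y` reduces to one and `s≤s z≤n`
  -- proves it positive.
  preserves⇒invariant pres x y 0<x@(s≤s _) 0<y = begin
    gcd (f x) (f y)        ≡⟨ pres x y 0<x 0<y ⟨
    f (gcd x y)            ≡⟨ cong f (gcd[m+n,n]≡gcd[m,n] x y) ⟨
    f (gcd (x + y) y)      ≡⟨ pres (x + y) y (s≤s z≤n) 0<y ⟩
    gcd (f (x + y)) (f y)  ∎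

  invariant⇒preserves :
    (∀ x y → 0 < x → 0 < y → gcd (f x) (f y) ≡ gcd (f (x + y)) (f y)) →
    ∀ m n → 0 < m → 0 < n → f (gcd m n) ≡ gcd (f m) (f n)
  -- The relation is the equation in (i) itself; (ii) enters only in the last argument, the Euclid
  -- step.
  invariant⇒preserves inv = euclid-induction
    (λ m n → f (gcd m n) ≡ gcd (f m) (f n))
    (λ {m} {n} eq → trans (cong f (gcd-comm n m)) (trans eq (gcd-comm (f m) (f n))))
    (λ n → trans (cong f (gcd-idem n)) (sym (gcd-idem (f n))))
    (λ x y 0<x 0<y eq → begin
      f (gcd (x + y) y)      ≡⟨ cong f (gcd[m+n,n]≡gcd[m,n] x y) ⟩
      f (gcd x y)            ≡⟨ eq ⟩
      gcd (f x) (f y)        ≡⟨ inv x y 0<x 0<y ⟩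
      gcd (f (x + y)) (f y)  ∎)
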